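{- Any $\varepsilon$-DP implicit representation scheme under the permutation representation for Triangle-Transversal has approximation ratio at least $\Omega(n\cdot e^{ -\varepsilon})$ on $n$-vertex graphs. That is, there are absolute constants $c>0$ and $n_0\in\mathbb{N}$ such that for every $n\ge n_0$ and every $\varepsilon>0$, if such a scheme satisfies $\mathbb{E}_{\pi\sim\mathcal{E}(G;k)}[|S_\pi(E)|]\le\alpha k$ for every $n$-vertex graph $G=(V,E)$ and every $k\ge\mathrm{opt}(G)$, then $\alpha\ge c\,n\,e^{ -\varepsilon}$.
   Context: Triangle-Transversal: given an undirected graph $G=(V,E)$, find a minimum-size $S\subseteq V$ such that $G[V\setminus S]$ contains no triangles; $\mathrm{opt}(G)$ is the optimum. Neighbors: two graphs $G=(V,E)$, $G'=(V,E')$ on the same vertex set are neighbors if $|E\triangle E'|\le1$. A randomized algorithm $\mathcal{M}$ is $\varepsilon$-DP if for all neighboring $G\sim G'$ and all sets $\mathcal{S}$ of outcomes, $\Pr[\mathcal{M}(G)\in\mathcal{S}]\le e^{\varepsilon}\Pr[\mathcal{M}(G')\in\mathcal{S}]$. Scheme under the permutation representation: the encoder $\mathcal{E}(G;k)$ is a randomized algorithm, $\varepsilon$-DP for each fixed parameter $k$ and with arbitrary running time, which outputs a permutation (total order) $\pi$ of $V$. The decoder is fixed: $\mathcal{D}(G,\pi)$ outputs $S_\pi(E)=\{\min_\pi(\{u,v,w\})\mid \{u,v,w\}\subseteq V,\ \{u,v\},\{v,w\},\{u,w\}\in E\}$, where $\min_\pi$ denotes the earliest element in $\pi$. -}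

module Defs where

open import Algebra.Apartness.Bundles using (HeytingField)
open import Algebra.Bundles using (CommutativeRing)
import Algebra.Definitions.RawMonoid as RawMonoidDefs
open import Data.Bool.Base using (Bool; false; T)
import Data.Bool.Properties as Bool
open import Data.Bool.Properties using (T?)
open import Data.Fin.Base using (Fin; toℕ)
import Data.Fin.Base as Fin
import Data.Fin.Properties as Fin
open import Data.Fin.Subset using (Subset; _∉_; ∣_∣; ⁅_⁆; ⋃; inside; outside)
open import Data.Fin.Subset.Properties using (_∈?_)
open import Data.List.Base
  using (List; []; _∷_; map; foldr; filter; length; allFin; cartesianProduct; cartesianProductWith)
open import Data.List.Extrema.Nat using (argmin; min)
open import Data.List.Relation.Unary.All using (All)
open import Data.Nat.Base as ℕ using (ℕ; zero; suc)
open import Data.Product.Base using (_×_; _,_; ∃-syntax)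
open import Data.Sum.Base using (_⊎_)
open import Data.Vec.Base as Vec using (Vec; []; _∷_)
open import Data.Vec.Relation.Unary.AllPairs using (allPairs?)
open import Data.Vec.Relation.Unary.Unique.Propositional using (Unique)
open import Function.Bundles using (_⇔_)
open import Level using (_⊔_) renaming (suc to lsuc)
open import Relation.Binary.Core using (Rel)
open import Relation.Binary.PropositionalEquality.Core using (_≡_)
open import Relation.Binary.Structures using (IsStrictPartialOrder)
open import Relation.Nullary.Decidable.Core using (Dec; _×-dec_; _→-dec_; ¬?)
open import Relation.Nullary.Negation.Core using (¬_)

------------------------------------------------------------------------
-- The real numbers
--
-- ℝ is given axiomatically, as a Cauchy complete Archimedean ordered field,
-- which determines it up to isomorphism.  Classically, the structure also
-- has a unique exponential function satisfying the last three fields.  The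
-- axioms are phrased so that the constructive reals satisfy them too:
-- apartness is "smaller or larger", and x ≤ y is ¬ (y < x).

record Reals c ℓ₁ ℓ₂ ℓ₃ : Set (lsuc (c ⊔ ℓ₁ ⊔ ℓ₂ ⊔ ℓ₃)) where
  infix 4 _<_ _≤_
  field
    heytingField : HeytingField c ℓ₁ ℓ₂

  open HeytingField heytingField public

  commutativeRing : CommutativeRing c ℓ₁
  commutativeRing = record { isCommutativeRing = isCommutativeRing }

  fromℕ : ℕ → Carrier
  fromℕ n = RawMonoidDefs._×_ (CommutativeRing.+-rawMonoid commutativeRing) n 1#

  field
    _<_                  : Rel Carrier ℓ₃
    isStrictPartialOrder : IsStrictPartialOrder _≈_ _<_
    #⇔<⊎>                : ∀ x y → x # y ⇔ (x < y ⊎ y < x)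
    +-mono-<             : ∀ z {x y} → x < y → x + z < y + z
    *-pos                : ∀ {x y} → 0# < x → 0# < y → 0# < x * y
    archimedean          : ∀ x → ∃[ n ] x < fromℕ n

  _≤_ : Rel Carrier ℓ₃
  x ≤ y = ¬ (y < x)

  -- Both conditions bound an absolute value: in the first one by exchanging
  -- m and n.
  Cauchy : (ℕ → Carrier) → Set (c ⊔ ℓ₃)
  Cauchy s = ∀ δ → 0# < δ →
    ∃[ N ] (∀ m n → N ℕ.≤ m → N ℕ.≤ n → s m < s n + δ)

  _ConvergesTo_ : (ℕ → Carrier) → Carrier → Set (c ⊔ ℓ₃)
  s ConvergesTo x = ∀ δ → 0# < δ →
    ∃[ N ] (∀ n → N ℕ.≤ n → s n < x + δ × x < s n + δ)

  field
    complete : ∀ s → Cauchy s → ∃[ x ] s ConvergesTo x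
    exp      : Carrier → Carrier
    exp-cong : ∀ {x y} → x ≈ y → exp x ≈ exp y
    exp-+    : ∀ x y → exp (x + y) ≈ exp x * exp y
    1+x≤exp  : ∀ x → 1# + x ≤ exp x

------------------------------------------------------------------------
-- Graphs on the vertex set Fin n

record Graph (n : ℕ) : Set where
  field
    adj    : Fin n → Fin n → Bool
    sym    : ∀ u v → adj u v ≡ adj v u
    irrefl : ∀ v → adj v v ≡ false

open Graph public using (adj)

vectors : ∀ {a} {A : Set a} → List A → ∀ n → List (Vec A n)
vectors xs zero    = [] ∷ []
vectors xs (suc n) = cartesianProductWith _∷_ xs (vectors xs n)

module _ {n : ℕ} where

  -- E △ E′, an edge being represented by the pair (u , v) with u < v.
  edgeDifference : Graph n → Graph n → List (Fin n × Fin n)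
  edgeDifference G G′ = filter
    (λ (u , v) → u Fin.<? v ×-dec ¬? (adj G u v Bool.≟ adj G′ u v))
    (cartesianProduct (allFin n) (allFin n))

  Neighbours : Graph n → Graph n → Set
  Neighbours G G′ = length (edgeDifference G G′) ℕ.≤ 1

  -- u, v and w are pairwise distinct because adj is irreflexive.
  Triangle : Graph n → Fin n → Fin n → Fin n → Set
  Triangle G u v w = T (adj G u v) × T (adj G v w) × T (adj G u w)

  triangle? : ∀ G u v w → Dec (Triangle G u v w)
  triangle? G u v w = T? _ ×-dec T? _ ×-dec T? _

  Transversal : Graph n → Subset n → Set
  Transversal G S = ∀ u v w → u ∉ S × v ∉ S × w ∉ S → ¬ Triangle G u v w

  transversal? : ∀ G S → Dec (Transversal G S)
  transversal? G S =
    Fin.all? λ u → Fin.all? λ v → Fin.all? λ w →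
      (¬? (u ∈? S) ×-dec ¬? (v ∈? S) ×-dec ¬? (w ∈? S)) →-dec ¬? (triangle? G u v w)

  subsets : List (Subset n)
  subsets = vectors (inside ∷ outside ∷ []) n

  -- The default n of min is the size of the transversal Fin n.
  opt : Graph n → ℕ
  opt G = min n (map ∣_∣ (filter (transversal? G) subsets))

------------------------------------------------------------------------
-- Permutations and the decoder

-- π is the vector of ranks of a total order on Fin n, u being earlier
-- than v when lookup π u < lookup π v.  The vectors that are permutations
-- are those in permutations n.
Ranking : ℕ → Set
Ranking n = Vec (Fin n) n

permutations : ∀ n → List (Ranking n)
permutations n = filter unique? (vectors (allFin n) n)
  where
  unique? : (π : Ranking n) → Dec (Unique π)
  unique? = allPairs? λ i j → ¬? (i Fin.≟ j)

module _ {n : ℕ} where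

  rank : Ranking n → Fin n → ℕ
  rank π v = toℕ (Vec.lookup π v)

  earliest : Ranking n → Fin n × Fin n × Fin n → Fin n
  earliest π (u , v , w) = argmin (rank π) u (v ∷ w ∷ [])

  triangles : Graph n → List (Fin n × Fin n × Fin n)
  triangles G = filter (λ (u , v , w) → triangle? G u v w)
    (cartesianProduct (allFin n) (cartesianProduct (allFin n) (allFin n)))

  decode : Graph n → Ranking n → Subset n
  decode G π = ⋃ (map (λ t → ⁅ earliest π t ⁆) (triangles G))

------------------------------------------------------------------------
-- Randomized algorithms and differential privacy

module Probability {c ℓ₁ ℓ₂ ℓ₃} (ℝ : Reals c ℓ₁ ℓ₂ ℓ₃) where
  open Reals ℝ

  sumOver : ∀ {a} {A : Set a} → List A → (A → Carrier) → Carrier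
  sumOver xs f = foldr (λ x s → f x + s) 0# xs

  -- Probability distributions on a finite sample space, listed by Ω without
  -- repetitions.
  record Distribution {a} {A : Set a} (Ω : List A) : Set (a ⊔ c ⊔ ℓ₁ ⊔ ℓ₃) where
    field
      mass     : A → Carrier
      mass-≥0  : All (λ x → 0# ≤ mass x) Ω
      mass-sum : sumOver Ω mass ≈ 1#

  open Distribution public

  module _ {a} {A : Set a} {Ω : List A} where

    Pr : Distribution Ω → (A → Bool) → Carrier
    Pr μ S = sumOver (filter (λ x → T? (S x)) Ω) (mass μ)

    𝔼 : Distribution Ω → (A → Carrier) → Carrier
    𝔼 μ f = sumOver Ω (λ x → mass μ x * f x)

    IsDP : ∀ {n} → Carrier → (Graph n → Distribution Ω) → Set (a ⊔ ℓ₃)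
    IsDP ε M = ∀ G G′ → Neighbours G G′ → ∀ S → Pr (M G) S ≤ exp ε * Pr (M G′) S

  Encoder : ℕ → Set (c ⊔ ℓ₁ ⊔ ℓ₃)
  Encoder n = Graph n → ℕ → Distribution (permutations n)

  IsDPEncoder : ∀ {n} → Carrier → Encoder n → Set ℓ₃
  IsDPEncoder ε 𝓔 = ∀ k → IsDP ε (λ G → 𝓔 G k)

  HasApproximationRatio : ∀ {n} → Encoder n → Carrier → Set ℓ₃
  HasApproximationRatio 𝓔 α = ∀ G k → opt G ℕ.≤ k →
    𝔼 (𝓔 G k) (λ π → fromℕ ∣ decode G π ∣) ≤ α * fromℕ k

{-# OPTIONS --safe #-}
module Submission where

-- With the parameter k = 1 fixed, one edge is enough to exploit the privacy
-- guarantee.  Start from a complete bipartite graph G₀, pick m ≈ n/4 disjoint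
-- pairs of vertices on each side, and join one pair by an edge.  The result is
-- a neighbour of G₀ whose triangles all contain that edge, so its optimum is at
-- most 1, and the decoder selects every opposite vertex that precedes both ends
-- of the edge.  In a fixed order, comparing the earlier vertices of a pair on
-- one side and of a pair on the other side, one of the two precedes both
-- vertices of the opposite pair; hence the 2m choices of the edge together
-- select at least m² vertices.  By privacy this holds, up to the factor exp ε,
-- with the order drawn for each modified graph, so m² ≤ 2m · exp ε · α.

open import Defs
open import Algebra.Bundles using (CommutativeRing)
open import Data.Bool.Base using (Bool; true; false; T; not; _∨_; _xor_)
open import Data.Bool.Properties using (T?; T-∨; xor-comm; xor-same; not-¬; ∨-identityʳ)
open import Data.Fin.Base as Fin using (Fin; toℕ; combine; inject≤)
open import Data.Fin.Patterns using (0F; 1F; 2F; 3F)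
import Data.Fin.Properties as Fin
open import Data.Fin.Subset using (Subset; _∈_; _∉_; ∣_∣; ⁅_⁆; ⋃; inside; outside)
open import Data.Fin.Subset.Properties
  using (x∈p∪q⁺; x∈⁅x⁆; x∉⁅y⁆⇒x≢y; ∣⁅x⁆∣≡1; x∈p∧x≢y⇒x∈p-y; x∈p⇒∣p-x∣<∣p∣)
open import Data.List.Base using (List; []; _∷_; filter; length; allFin; cartesianProduct)
open import Data.List.Extrema.Nat using (argmin; argmin-all; min≤v⁺)
open import Data.List.Membership.Propositional using (lose) renaming (_∈_ to _∈ˡ_)
open import Data.List.Membership.Propositional.Properties
  using (∈-map⁺; ∈-filter⁺; ∈-filter⁻; ∈-allFin; ∈-cartesianProduct⁺; ∈-cartesianProductWith⁺)
open import Data.List.Properties using (length-map; length-tabulate)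
open import Data.List.Relation.Unary.All as All using (All; []; _∷_)
open import Data.List.Relation.Unary.All.Properties using (all-filter) renaming (map⁺ to All-map⁺)
open import Data.List.Relation.Unary.AllPairs using ([]; _∷_)
open import Data.List.Relation.Unary.Any using (here; there)
open import Data.List.Relation.Unary.Unique.Propositional using (Unique)
import Data.List.Relation.Unary.Unique.Propositional.Properties as Unique
open import Data.Nat.Base as ℕ using (ℕ; zero; suc; z≤n; s≤s)
open import Data.Nat.DivMod using ([m+kn]%n≡m%n; m≡m%n+[m/n]*n; m%n<n; m/n*n≤m; m≥n⇒m/n>0)
import Data.Nat.Properties as ℕ
open import Data.Nat.Tactic.RingSolver using (solve-∀)
open import Data.Product.Base using (_×_; _,_; proj₁; proj₂; ∃-syntax; Σ-syntax)
open import Data.Sum.Base as Sum using (_⊎_; inj₁; inj₂)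
open import Data.Vec.Base using (Vec; []; _∷_)
open import Function.Base using (_∘_; id)
open import Function.Bundles using (mk⇔; Equivalence)
open import Relation.Binary.PropositionalEquality as ≡ using (_≡_; _≢_; ≢-sym)
open import Relation.Binary.Structures using (IsPreorder; IsStrictPartialOrder)
open import Relation.Nullary.Decidable.Core
  using (Dec; yes; no; does; ¬?; _×-dec_; _⊎-dec_)
open import Relation.Nullary.Decidable using (does-⇔; dec-false; decidable-stable)
open import Relation.Nullary.Negation.Core using (¬_; contradiction)

-- Finite sets, enumerations and Booleans.

length≤∣p∣ : ∀ {n} {p : Subset n} {xs} → Unique xs → All (_∈ p) xs → length xs ℕ.≤ ∣ p ∣
length≤∣p∣ [] [] = z≤n
length≤∣p∣ (x≢xs ∷ xs!) (x∈p ∷ xs∈p) = ℕ.≤-<-trans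
  (length≤∣p∣ xs! (All.zipWith (λ (y∈p , x≢y) → x∈p∧x≢y⇒x∈p-y y∈p (≢-sym x≢y)) (xs∈p , x≢xs)))
  (x∈p⇒∣p-x∣<∣p∣ x∈p)

∈-⋃ : ∀ {n} {x : Fin n} {p ps} → p ∈ˡ ps → x ∈ p → x ∈ ⋃ ps
∈-⋃ (here ≡.refl) x∈p = x∈p∪q⁺ (inj₁ x∈p)
∈-⋃ (there p∈ps) x∈p = x∈p∪q⁺ (inj₂ (∈-⋃ p∈ps x∈p))

∈-vectors : ∀ {a} {A : Set a} {xs : List A} → (∀ x → x ∈ˡ xs) →
  ∀ {n} (v : Vec A n) → v ∈ˡ vectors xs n
∈-vectors ∈xs []      = here ≡.refl
∈-vectors ∈xs (x ∷ v) = ∈-cartesianProductWith⁺ _∷_ (∈xs x) (∈-vectors ∈xs v)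

∈-subsets : ∀ {n} (p : Subset n) → p ∈ˡ subsets
∈-subsets = ∈-vectors λ where
  inside  → here ≡.refl
  outside → there (here ≡.refl)

-- Serves to bound the length of `edgeDifference`, which is a filtered list without repetitions.
unique∧constant⇒length≤1 : ∀ {a} {A : Set a} {xs : List A} →
  Unique xs → (∀ {x y} → x ∈ˡ xs → y ∈ˡ xs → x ≡ y) → length xs ℕ.≤ 1
unique∧constant⇒length≤1 {xs = []} _ _ = z≤n
unique∧constant⇒length≤1 {xs = _ ∷ []} _ _ = s≤s z≤n
unique∧constant⇒length≤1 {xs = _ ∷ _ ∷ _} ((x≢y ∷ _) ∷ _) same =
  contradiction (same (here ≡.refl) (there (here ≡.refl))) x≢y

-- Three Booleans cannot be pairwise distinct; this is why `bipartite side` has no triangle.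
xor-triangle : ∀ a b c → T (a xor b) → T (b xor c) → ¬ T (a xor c)
xor-triangle false false _     ()
xor-triangle false true  true  _ ()
xor-triangle false true  false _ _ ()
xor-triangle true  true  _     ()
xor-triangle true  false false _ ()
xor-triangle true  false true  _ _ ()

T-xor : ∀ {a b} → a ≢ b → T (a xor b)
T-xor {true}  {true}  a≢b = contradiction ≡.refl a≢b
T-xor {true}  {false} a≢b = _
T-xor {false} {true}  a≢b = _
T-xor {false} {false} a≢b = contradiction ≡.refl a≢b

T-does⁻ : ∀ {p} {P : Set p} (P? : Dec P) → T (does P?) → P
T-does⁻ (yes p) _ = p

T-does⁺ : ∀ {p} {P : Set p} (P? : Dec P) → P → T (does P?)
T-does⁺ (yes _) _ = _
T-does⁺ (no ¬p) p = contradiction p ¬p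

-- argmin resolves ties in favour of the head of the list, so that rankings
-- need not be injective below.
argmin-head : ∀ {a} {A : Set a} (f : A → ℕ) {x y} → f x ℕ.≤ f y → argmin f y (x ∷ []) ≡ x
argmin-head f {x} {y} x≤y with f x ℕ.≤? f y
... | yes _  = ≡.refl
... | no x≰y = contradiction x≤y x≰y

-- Complete bipartite graphs with one added edge.

module _ {n : ℕ} where

  -- The fold behind `argmin` compares `v` with the minimum of `w` and the default `u`, and its head
  -- wins ties. Hence the triangle used below has its earliest vertex in the middle.
  earliest-middle : ∀ (π : Ranking n) {u v w} → rank π v ℕ.≤ rank π u → rank π v ℕ.≤ rank π w →
    earliest π (u , v , w) ≡ v
  earliest-middle π {u} {v} {w} v≤u v≤w = argmin-head (rank π)
    (argmin-all (rank π) {P = λ z → rank π v ℕ.≤ rank π z} v≤u (v≤w ∷ []))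

  bipartite : (Fin n → Bool) → Graph n
  bipartite side = record
    { adj    = λ u v → side u xor side v
    ; sym    = λ u v → xor-comm (side u) (side v)
    ; irrefl = λ v → xor-same (side v)
    }

  IsEdge : (x y u v : Fin n) → Set
  IsEdge x y u v = u ≡ x × v ≡ y ⊎ u ≡ y × v ≡ x

  isEdge? : ∀ x y u v → Dec (IsEdge x y u v)
  isEdge? x y u v = (u Fin.≟ x ×-dec v Fin.≟ y) ⊎-dec (u Fin.≟ y ×-dec v Fin.≟ x)

  addEdge : Graph n → (x y : Fin n) → x ≢ y → Graph n
  addEdge G x y x≢y = record
    { adj    = λ u v → adj G u v ∨ does (isEdge? x y u v)
    ; sym    = λ u v → ≡.cong₂ _∨_ (Graph.sym G u v)
        (does-⇔ (mk⇔ swap swap) (isEdge? x y u v) (isEdge? x y v u))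
    ; irrefl = λ v → ≡.cong₂ _∨_ (Graph.irrefl G v) (dec-false (isEdge? x y v v)
        λ { (inj₁ (≡.refl , v≡y)) → x≢y v≡y ; (inj₂ (≡.refl , v≡x)) → x≢y (≡.sym v≡x) })
    }
    where
    swap : ∀ {u v} → IsEdge x y u v → IsEdge x y v u
    swap (inj₁ (u≡x , v≡y)) = inj₂ (v≡y , u≡x)
    swap (inj₂ (u≡y , v≡x)) = inj₁ (v≡x , u≡y)

  module _ (G : Graph n) {x y : Fin n} (x≢y : x ≢ y) where

    adj-addEdge⁻ : ∀ {u v} → T (adj (addEdge G x y x≢y) u v) → T (adj G u v) ⊎ IsEdge x y u v
    adj-addEdge⁻ {u} {v} = Sum.map₂ (T-does⁻ (isEdge? x y u v)) ∘ Equivalence.to T-∨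

    adj-addEdge⁺ : ∀ {u v} → T (adj G u v) ⊎ IsEdge x y u v → T (adj (addEdge G x y x≢y) u v)
    adj-addEdge⁺ {u} {v} = Equivalence.from T-∨ ∘ Sum.map₂ (T-does⁺ (isEdge? x y u v))

    -- Only pairs with `u < v` are listed, so at most one orientation of the new edge occurs: the
    -- mixed cases of `same` would need both `x < y` and `y < x`.
    addEdge-neighbours : Neighbours G (addEdge G x y x≢y)
    addEdge-neighbours = unique∧constant⇒length≤1
      (Unique.filter⁺ _ (Unique.cartesianProduct⁺ (Unique.allFin⁺ n) (Unique.allFin⁺ n)))
      λ p q → same (difference p) (difference q)
      where
      difference : ∀ {e} → e ∈ˡ edgeDifference G (addEdge G x y x≢y) →
        proj₁ e Fin.< proj₂ e × IsEdge x y (proj₁ e) (proj₂ e)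
      difference {u , v} e∈
        with _ , u<v , adj≢ ← ∈-filter⁻ _ {xs = cartesianProduct (allFin n) (allFin n)} e∈ =
        u<v , decidable-stable (isEdge? x y u v) λ ¬e → adj≢
          (≡.sym (≡.trans (≡.cong (adj G u v ∨_) (dec-false (isEdge? x y u v) ¬e)) (∨-identityʳ _)))

      same : ∀ {e f} → proj₁ e Fin.< proj₂ e × IsEdge x y (proj₁ e) (proj₂ e) →
        proj₁ f Fin.< proj₂ f × IsEdge x y (proj₁ f) (proj₂ f) → e ≡ f
      same (_   , inj₁ (≡.refl , ≡.refl)) (_   , inj₁ (≡.refl , ≡.refl)) = ≡.refl
      same (x<y , inj₁ (≡.refl , ≡.refl)) (y<x , inj₂ (≡.refl , ≡.refl)) = contradiction x<y (ℕ.<-asym y<x)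
      same (y<x , inj₂ (≡.refl , ≡.refl)) (x<y , inj₁ (≡.refl , ≡.refl)) = contradiction x<y (ℕ.<-asym y<x)
      same (_   , inj₂ (≡.refl , ≡.refl)) (_   , inj₂ (≡.refl , ≡.refl)) = ≡.refl

  opt≤∣S∣ : ∀ (G : Graph n) {S} → Transversal G S → opt G ℕ.≤ ∣ S ∣
  opt≤∣S∣ G {S} tr = min≤v⁺ n _
    (inj₂ (lose (∈-map⁺ ∣_∣ (∈-filter⁺ (transversal? G) (∈-subsets S) tr)) ℕ.≤-refl))

  -- The end `x` of the new edge is a transversal by itself: a triangle avoiding `x` would lie in
  -- the bipartite graph.
  opt-bipartite+edge≤1 : ∀ side {x y : Fin n} (x≢y : x ≢ y) →
    opt (addEdge (bipartite side) x y x≢y) ℕ.≤ 1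
  opt-bipartite+edge≤1 side {x} {y} x≢y =
    ≡.subst (opt (addEdge (bipartite side) x y x≢y) ℕ.≤_) (∣⁅x⁆∣≡1 x)
      (opt≤∣S∣ (addEdge (bipartite side) x y x≢y) transversal)
    where
    old : ∀ {u v} → u ∉ ⁅ x ⁆ → v ∉ ⁅ x ⁆ → T (adj (addEdge (bipartite side) x y x≢y) u v) →
      T (side u xor side v)
    old u∉ v∉ uv with adj-addEdge⁻ (bipartite side) x≢y uv
    ... | inj₁ uv′              = uv′
    ... | inj₂ (inj₁ (u≡x , _)) = contradiction u≡x (x∉⁅y⁆⇒x≢y u∉)
    ... | inj₂ (inj₂ (_ , v≡x)) = contradiction v≡x (x∉⁅y⁆⇒x≢y v∉)

    transversal : Transversal (addEdge (bipartite side) x y x≢y) ⁅ x ⁆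
    transversal u v w (u∉ , v∉ , w∉) (uv , vw , uw) =
      xor-triangle (side u) (side v) (side w) (old u∉ v∉ uv) (old v∉ w∉ vw) (old u∉ w∉ uw)

  earliest∈decode : ∀ (G : Graph n) π {u v w} → Triangle G u v w → earliest π (u , v , w) ∈ decode G π
  earliest∈decode G π {u} {v} {w} uvw = ∈-⋃
    (∈-map⁺ _ (∈-filter⁺ (λ (u , v , w) → triangle? G u v w)
      (∈-cartesianProduct⁺ (∈-allFin u) (∈-cartesianProduct⁺ (∈-allFin v) (∈-allFin w))) uvw))
    (x∈⁅x⁆ _)

  -- Being opposite to both ends of the new edge, `z` is adjacent to them, so `x`, `z`, `y` form a
  -- triangle, from which the decoder selects `z`.
  ∈-decode-bipartite+edge : ∀ side {x y z : Fin n} (x≢y : x ≢ y) π →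
    side z ≢ side x → side z ≢ side y → rank π z ℕ.≤ rank π x → rank π z ℕ.≤ rank π y →
    z ∈ decode (addEdge (bipartite side) x y x≢y) π
  ∈-decode-bipartite+edge side {x} {y} {z} x≢y π z≁x z≁y z≤x z≤y =
    ≡.subst (_∈ decode G π) (earliest-middle π z≤x z≤y)
      (earliest∈decode G π
        ( adj-addEdge⁺ (bipartite side) x≢y (inj₁ (T-xor (≢-sym z≁x)))
        , adj-addEdge⁺ (bipartite side) x≢y (inj₁ (T-xor z≁y))
        , adj-addEdge⁺ (bipartite side) x≢y (inj₂ (inj₁ (≡.refl , ≡.refl)))))
    where G = addEdge (bipartite side) x y x≢y

-- Disjoint pairs of vertices on the two sides.

module Pairs (m : ℕ) {n} (m*4≤n : m ℕ.* 4 ℕ.≤ n) where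

  -- Block `i` consists of the vertices `4i` to `4i + 3`: the first two are pair `i` of side
  -- `false`, the last two pair `i` of side `true`. The second argument chooses an end of the pair.
  residue : Bool → Bool → Fin 4
  residue false false = 0F
  residue false true  = 1F
  residue true  false = 2F
  residue true  true  = 3F

  vertex : Bool → Fin m → Bool → Fin n
  vertex s i c = inject≤ (combine i (residue s c)) m*4≤n

  -- The residue modulo 4 also assigns a side to the vertices from `m * 4` on, which belong to no
  -- pair.
  side : Fin n → Bool
  side v = does (2 ℕ.≤? toℕ v ℕ.% 4)

  side-vertex : ∀ s i c → side (vertex s i c) ≡ s
  side-vertex s i c = ≡.trans (≡.cong (λ r → does (2 ℕ.≤? r)) vertex%4) (side-residue s c)
    where
    vertex%4 : toℕ (vertex s i c) ℕ.% 4 ≡ toℕ (residue s c) ℕ.% 4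
    vertex%4 = ≡.trans
      (≡.cong (ℕ._% 4) (≡.trans (Fin.toℕ-inject≤ _ m*4≤n) (≡.trans (Fin.toℕ-combine i (residue s c))
        (≡.trans (ℕ.+-comm (4 ℕ.* toℕ i) _) (≡.cong (toℕ (residue s c) ℕ.+_) (ℕ.*-comm 4 (toℕ i)))))))
      ([m+kn]%n≡m%n (toℕ (residue s c)) (toℕ i) 4)

    side-residue : ∀ s c → does (2 ℕ.≤? toℕ (residue s c) ℕ.% 4) ≡ s
    side-residue false false = ≡.refl
    side-residue false true  = ≡.refl
    side-residue true  false = ≡.refl
    side-residue true  true  = ≡.refl

  -- The ends `c` and `d` may differ, so pairs of one side are disjoint and their heads are distinct
  -- however `π` chooses them.
  vertex-injective : ∀ {s i c j d} → vertex s i c ≡ vertex s j d → i ≡ j × residue s c ≡ residue s d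
  vertex-injective {s} {i} {c} {j} {d} eq =
    Fin.combine-injective i (residue s c) j (residue s d) (Fin.inject≤-injective m*4≤n m*4≤n _ _ eq)

  pair-distinct : ∀ s i → vertex s i false ≢ vertex s i true
  pair-distinct s i eq = distinct s (proj₂ (vertex-injective {s} {i} {false} {i} {true} eq))
    where
    distinct : ∀ s → residue s false ≢ residue s true
    distinct false ()
    distinct true  ()

  G₀ : Graph n
  G₀ = bipartite side

  G[_,_] : Bool → Fin m → Graph n
  G[ s , i ] = addEdge G₀ (vertex s i false) (vertex s i true) (pair-distinct s i)

  module _ (π : Ranking n) where

    earlier : ∀ s i → ∃[ c ] (∀ d → rank π (vertex s i c) ℕ.≤ rank π (vertex s i d))
    earlier s i with ℕ.≤-total (rank π (vertex s i false)) (rank π (vertex s i true))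
    ... | inj₁ f≤t = false , λ { false → ℕ.≤-refl ; true → f≤t }
    ... | inj₂ t≤f = true  , λ { false → t≤f ; true → ℕ.≤-refl }

    head : Bool → Fin m → Fin n
    head s i = vertex s i (proj₁ (earlier s i))

    -- A head that is no later than `head s i` is no later than either end of the added edge, hence
    -- selected; different `j` give different heads.
    length≤∣decode∣ : ∀ s i (P : Fin m → Bool) →
      (∀ j → T (P j) → rank π (head (not s) j) ℕ.≤ rank π (head s i)) →
      length (filter (λ j → T? (P j)) (allFin m)) ℕ.≤ ∣ decode G[ s , i ] π ∣
    length≤∣decode∣ s i P first = ≡.subst (ℕ._≤ ∣ decode G[ s , i ] π ∣) (length-map (head (not s)) Js)
      (length≤∣p∣
        (Unique.map⁺ (λ {j} {k} eq → proj₁ (vertex-injective {not s} {j} {_} {k} eq))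
          (Unique.filter⁺ _ (Unique.allFin⁺ m)))
        (All-map⁺ (All.map (λ {j} → head∈decode j) (all-filter (λ j → T? (P j)) (allFin m)))))
      where
      Js = filter (λ j → T? (P j)) (allFin m)

      opposite : ∀ j c → side (head (not s) j) ≢ side (vertex s i c)
      opposite j c eq =
        not-¬ ≡.refl (≡.sym (≡.trans (≡.sym (side-vertex (not s) j _)) (≡.trans eq (side-vertex s i c))))

      head∈decode : ∀ j → T (P j) → head (not s) j ∈ decode G[ s , i ] π
      head∈decode j Pj = ∈-decode-bipartite+edge side (pair-distinct s i) π
        (opposite j false) (opposite j true) (before false) (before true)
        where
        before : ∀ c → rank π (head (not s) j) ℕ.≤ rank π (vertex s i c)
        before c = ℕ.≤-trans (first j Pj) (proj₂ (earlier s i) c)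

-- Ordered field arithmetic and the exponential.

module RealProperties {a ℓ₁ ℓ₂ ℓ₃} (ℝ : Reals a ℓ₁ ℓ₂ ℓ₃) where
  open Reals ℝ
  open Probability ℝ
  open CommutativeRing commutativeRing using (ring; semiring)
  open IsStrictPartialOrder isStrictPartialOrder public
    using (<-resp-≈)
    renaming (irrefl to <-irrefl; trans to <-trans; asym to <-asym)
  open import Algebra.Apartness.Properties.HeytingCommutativeRing heytingCommutativeRing
    using (1#0; x-0≈x; invertibleʳ⇒#)
  open import Algebra.Properties.CommutativeSemigroup
    (CommutativeRing.+-commutativeSemigroup commutativeRing) using (interchange; x∙yz≈y∙xz)
  open import Algebra.Properties.Ring ring
    using (-‿distribˡ-*; -‿involutive; [y-z]x≈yx-zx)
  open import Algebra.Properties.Semiring.Mult semiring public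
    using (×-homo-+; ×-homo-1; ×-congʳ; ×-congˡ; ×-comm-*; ×-assocˡ)
    renaming (_×_ to _·_)

  -- Cotransitivity of apartness; an inequality in the wrong direction is repaired with `x < y`.
  -- This replaces trichotomy and makes `<` compose with the negatively defined `≤`.
  <-cotrans : ∀ {x y} → x < y → ∀ z → x < z ⊎ z < y
  <-cotrans {x} {y} x<y z with #-cotrans (Equivalence.from (#⇔<⊎> x y) (inj₁ x<y)) z
  ... | inj₁ x#z with Equivalence.to (#⇔<⊎> x z) x#z
  ...   | inj₁ x<z = inj₁ x<z
  ...   | inj₂ z<x = inj₂ (<-trans z<x x<y)
  <-cotrans {x} {y} x<y z | inj₂ z#y with Equivalence.to (#⇔<⊎> z y) z#y
  ...   | inj₁ z<y = inj₂ z<y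
  ...   | inj₂ y<z = inj₁ (<-trans x<y y<z)

  <-≤-trans : ∀ {x y z} → x < y → y ≤ z → x < z
  <-≤-trans {z = z} x<y y≤z with <-cotrans x<y z
  ... | inj₁ x<z = x<z
  ... | inj₂ z<y = contradiction z<y y≤z

  ≤-<-trans : ∀ {x y z} → x ≤ y → y < z → x < z
  ≤-<-trans {x} x≤y y<z with <-cotrans y<z x
  ... | inj₁ y<x = contradiction y<x x≤y
  ... | inj₂ x<z = x<z

  ≤-isPreorder : IsPreorder _≈_ _≤_
  ≤-isPreorder = record
    { isEquivalence = isEquivalence
    ; reflexive     = λ x≈y → <-irrefl (sym x≈y)
    ; trans         = λ x≤y y≤z z<x → y≤z (<-≤-trans z<x x≤y)
    }

  module ≤-Reasoning where
    open import Relation.Binary.Reasoning.Base.Triple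
      ≤-isPreorder <-asym <-trans <-resp-≈ <-asym <-≤-trans ≤-<-trans public

  open ≤-Reasoning

  +-cancelʳ-< : ∀ z {x y} → x + z < y + z → x < y
  +-cancelʳ-< z {x} {y} x+z<y+z = begin-strict
    x          ≈⟨ cancel x ⟨
    x + z - z  <⟨ +-mono-< (- z) x+z<y+z ⟩
    y + z - z  ≈⟨ cancel y ⟩
    y          ∎
    where
    cancel : ∀ w → w + z - z ≈ w
    cancel w = trans (+-assoc w z (- z)) (trans (+-congˡ (-‿inverseʳ z)) (+-identityʳ w))

  +-mono-≤ : ∀ {x y u v} → x ≤ y → u ≤ v → x + u ≤ y + v
  +-mono-≤ {x} {y} {u} {v} x≤y u≤v = begin
    x + u  ≤⟨ x≤y ∘ +-cancelʳ-< u ⟩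
    y + u  ≈⟨ +-comm y u ⟩
    u + y  ≤⟨ u≤v ∘ +-cancelʳ-< y ⟩
    v + y  ≈⟨ +-comm v y ⟩
    y + v  ∎

  x<y⇒0<y-x : ∀ {x y} → x < y → 0# < y - x
  x<y⇒0<y-x {x} {y} x<y = begin-strict
    0#     ≈⟨ -‿inverseʳ x ⟨
    x - x  <⟨ +-mono-< (- x) x<y ⟩
    y - x  ∎

  0<y-x⇒x<y : ∀ {x y} → 0# < y - x → x < y
  0<y-x⇒x<y {x} {y} 0<y-x = +-cancelʳ-< (- x) (begin-strict
    x - x  ≈⟨ -‿inverseʳ x ⟩
    0#     <⟨ 0<y-x ⟩
    y - x  ∎)

  *-monoˡ-< : ∀ {x y z} → 0# < z → x < y → x * z < y * z
  *-monoˡ-< {x} {y} {z} 0<z x<y = 0<y-x⇒x<y (begin-strict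
    0#             <⟨ *-pos (x<y⇒0<y-x x<y) 0<z ⟩
    (y - x) * z    ≈⟨ [y-z]x≈yx-zx z y x ⟩
    y * z - x * z  ∎)

  *-monoʳ-< : ∀ {x y z} → 0# < z → x < y → z * x < z * y
  *-monoʳ-< {x} {y} {z} 0<z x<y = begin-strict
    z * x  ≈⟨ *-comm z x ⟩
    x * z  <⟨ *-monoˡ-< 0<z x<y ⟩
    y * z  ≈⟨ *-comm y z ⟩
    z * y  ∎

  -- Apartness leaves two signs, and if 1 were negative then 1 would still be positive, as the
  -- square of the positive number -1.
  0<1 : 0# < 1#
  0<1 with Equivalence.to (#⇔<⊎> 1# 0#) 1#0
  ... | inj₂ 0<1 = 0<1
  ... | inj₁ 1<0 = begin-strict
    0#             <⟨ *-pos 0<-1 0<-1 ⟩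
    - 1# * - 1#    ≈⟨ -‿distribˡ-* 1# (- 1#) ⟨
    - (1# * - 1#)  ≈⟨ -‿cong (*-identityˡ (- 1#)) ⟩
    - - 1#         ≈⟨ -‿involutive 1# ⟩
    1#             ∎
    where
    0<-1 : 0# < - 1#
    0<-1 = begin-strict
      0#       <⟨ x<y⇒0<y-x 1<0 ⟩
      0# - 1#  ≈⟨ +-identityˡ (- 1#) ⟩
      - 1#     ∎

  -- The inverse is itself invertible, hence apart from 0, and a negative one would make the product
  -- 1 negative. The field axiom inverts `x - 0#`, whence the rewriting by `x-0≈x`.
  positive-inverse : ∀ {x} → 0# < x → ∃[ y ] (0# < y × x * y ≈ 1#)
  positive-inverse {x} 0<x
    with y , _ , xy≈1 ← #⇒invertible (Equivalence.from (#⇔<⊎> x 0#) (inj₂ 0<x)) =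
    y , positive , x*y≈1
    where
    x*y≈1 : x * y ≈ 1#
    x*y≈1 = trans (*-congʳ (sym (x-0≈x x))) xy≈1

    positive : 0# < y
    positive with Equivalence.to (#⇔<⊎> y 0#)
                    (invertibleʳ⇒# (x , trans (*-congʳ (x-0≈x y)) (trans (*-comm y x) x*y≈1)))
    ... | inj₂ 0<y = 0<y
    ... | inj₁ y<0 = contradiction 0<1 (<-asym (begin-strict
      1#      ≈⟨ x*y≈1 ⟨
      x * y   <⟨ *-monoʳ-< 0<x y<0 ⟩
      x * 0#  ≈⟨ zeroʳ x ⟩
      0#      ∎))

  -- Since `≤` is a negation, it suffices to cancel `z` from the opposite strict inequality, by
  -- multiplying with its inverse.
  *-monoʳ-≤ : ∀ {x y z} → 0# < z → x ≤ y → z * x ≤ z * y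
  *-monoʳ-≤ {x} {y} {z} 0<z x≤y zy<zx with w , 0<w , zw≈1 ← positive-inverse 0<z = x≤y (begin-strict
    y            ≈⟨ cancel y ⟨
    w * (z * y)  <⟨ *-monoʳ-< 0<w zy<zx ⟩
    w * (z * x)  ≈⟨ cancel x ⟩
    x            ∎)
    where
    cancel : ∀ v → w * (z * v) ≈ v
    cancel v = trans (sym (*-assoc w z v)) (trans (*-congʳ (trans (*-comm w z) zw≈1)) (*-identityˡ v))

  ·-nonneg : ∀ n {x} → 0# ≤ x → 0# ≤ n · x
  ·-nonneg zero    0≤x = <-irrefl refl
  ·-nonneg (suc n) {x} 0≤x = begin
    0#         ≈⟨ +-identityˡ 0# ⟨
    0# + 0#    ≤⟨ +-mono-≤ 0≤x (·-nonneg n 0≤x) ⟩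
    x + n · x  ∎

  ·-monoˡ-≤ : ∀ {m n x} → m ℕ.≤ n → 0# ≤ x → m · x ≤ n · x
  ·-monoˡ-≤ {n = n} z≤n       0≤x = ·-nonneg n 0≤x
  ·-monoˡ-≤         (s≤s m≤n) 0≤x = +-mono-≤ (<-irrefl refl) (·-monoˡ-≤ m≤n 0≤x)

  *-fromℕ : ∀ x n → x * fromℕ n ≈ n · x
  *-fromℕ x n = trans (×-comm-* n x 1#) (×-congʳ n (*-identityʳ x))

  ·-positive : ∀ n .{{_ : ℕ.NonZero n}} {x} → 0# < x → 0# < n · x
  ·-positive (suc n) {x} 0<x = begin-strict
    0#          <⟨ 0<x ⟩
    x           ≈⟨ ×-homo-1 x ⟨
    1 · x       ≤⟨ ·-monoˡ-≤ {1} {suc n} (s≤s z≤n) (<-asym 0<x) ⟩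
    suc n · x   ∎

  ·-monoʳ-< : ∀ n .{{_ : ℕ.NonZero n}} {x y} → x < y → n · x < n · y
  ·-monoʳ-< n {x} {y} x<y = begin-strict
    n · x        ≈⟨ *-fromℕ x n ⟨
    x * fromℕ n  <⟨ *-monoˡ-< (·-positive n 0<1) x<y ⟩
    y * fromℕ n  ≈⟨ *-fromℕ y n ⟩
    n · y        ∎

  exp-positive : ∀ {x} → 0# ≤ x → 0# < exp x
  exp-positive {x} 0≤x = begin-strict
    0#       <⟨ 0<1 ⟩
    1#       ≈⟨ +-identityʳ 1# ⟨
    1# + 0#  ≤⟨ +-mono-≤ (<-irrefl refl) 0≤x ⟩
    1# + x   ≤⟨ 1+x≤exp x ⟩
    exp x    ∎

  -- By `exp-+`, `exp 0#` is idempotent; being positive, it can be cancelled.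
  exp-0 : exp 0# ≈ 1#
  exp-0 with y , _ , e*y≈1 ← positive-inverse (exp-positive (<-irrefl (refl {0#}))) = begin-equality
    exp 0#                 ≈⟨ *-identityʳ (exp 0#) ⟨
    exp 0# * 1#            ≈⟨ *-congˡ e*y≈1 ⟨
    exp 0# * (exp 0# * y)  ≈⟨ *-assoc (exp 0#) (exp 0#) y ⟨
    exp 0# * exp 0# * y    ≈⟨ *-congʳ (exp-+ 0# 0#) ⟨
    exp (0# + 0#) * y      ≈⟨ *-congʳ (exp-cong (+-identityˡ 0#)) ⟩
    exp 0# * y             ≈⟨ e*y≈1 ⟩
    1#                     ∎

  exp-inverse : ∀ x → exp (- x) * exp x ≈ 1#
  exp-inverse x = begin-equality
    exp (- x) * exp x  ≈⟨ exp-+ (- x) x ⟨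
    exp (- x + x)      ≈⟨ exp-cong (-‿inverseˡ x) ⟩
    exp 0#             ≈⟨ exp-0 ⟩
    1#                 ∎

  -- Finite sums.

  module _ {b} {B : Set b} where

    sumOver-cong : ∀ (xs : List B) {f g} → (∀ x → f x ≈ g x) → sumOver xs f ≈ sumOver xs g
    sumOver-cong []       f≈g = refl
    sumOver-cong (x ∷ xs) f≈g = +-cong (f≈g x) (sumOver-cong xs f≈g)

    sumOver-mono-≤ : ∀ {xs : List B} {f g} → All (λ x → f x ≤ g x) xs → sumOver xs f ≤ sumOver xs g
    sumOver-mono-≤ []              = <-irrefl refl
    sumOver-mono-≤ (fx≤gx ∷ f≤g) = +-mono-≤ fx≤gx (sumOver-mono-≤ f≤g)

    sumOver-+ : ∀ (xs : List B) f g → sumOver xs (λ x → f x + g x) ≈ sumOver xs f + sumOver xs g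
    sumOver-+ []       f g = sym (+-identityˡ 0#)
    sumOver-+ (x ∷ xs) f g = trans (+-congˡ (sumOver-+ xs f g)) (interchange (f x) (g x) _ _)

    sumOver-const : ∀ (xs : List B) x → sumOver xs (λ _ → x) ≈ length xs · x
    sumOver-const []       x = refl
    sumOver-const (_ ∷ xs) x = +-congˡ (sumOver-const xs x)

    *-distribˡ-sumOver : ∀ x (xs : List B) f → x * sumOver xs f ≈ sumOver xs (λ y → x * f y)
    *-distribˡ-sumOver x []       f = zeroʳ x
    *-distribˡ-sumOver x (y ∷ xs) f = trans (distribˡ x (f y) _) (+-congˡ (*-distribˡ-sumOver x xs f))

    -- For `f` a mass function: the probabilities of complementary events add up to the total mass.
    sumOver-filter-not : ∀ (xs : List B) (P : B → Bool) f →
      sumOver (filter (T? ∘ P) xs) f + sumOver (filter (T? ∘ not ∘ P) xs) f ≈ sumOver xs f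
    sumOver-filter-not []       P f = +-identityˡ 0#
    sumOver-filter-not (x ∷ xs) P f with P x
    ... | true  = trans (+-assoc (f x) _ _) (+-congˡ (sumOver-filter-not xs P f))
    ... | false = trans (x∙yz≈y∙xz _ (f x) _) (+-congˡ (sumOver-filter-not xs P f))

    sumOver-zero : ∀ (xs : List B) → sumOver xs (λ _ → 0#) ≈ 0#
    sumOver-zero []       = refl
    sumOver-zero (_ ∷ xs) = trans (+-identityˡ _) (sumOver-zero xs)

  module _ {b c} {B : Set b} {C : Set c} where

    sumOver-comm : ∀ (xs : List B) (ys : List C) (f : B → C → Carrier) →
      sumOver xs (λ x → sumOver ys (f x)) ≈ sumOver ys (λ y → sumOver xs (λ x → f x y))
    sumOver-comm []       ys f = sym (sumOver-zero ys)
    sumOver-comm (x ∷ xs) ys f =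
      trans (+-congˡ (sumOver-comm xs ys f)) (sym (sumOver-+ ys (f x) _))

    -- Double counting: both sides sum f over the pairs (x , y) with P x y.
    sumOver-filter-comm : ∀ (xs : List B) (ys : List C) (P : B → C → Bool) f →
      sumOver xs (λ x → sumOver (filter (λ y → T? (P x y)) ys) f) ≈
      sumOver ys (λ y → length (filter (λ x → T? (P x y)) xs) · f y)
    sumOver-filter-comm []       ys P f = sym (sumOver-zero ys)
    sumOver-filter-comm (x ∷ xs) ys P f = begin-equality
      sumOver (filter (λ y → T? (P x y)) ys) f +
      sumOver xs (λ x → sumOver (filter (λ y → T? (P x y)) ys) f)
        ≈⟨ +-congˡ (sumOver-filter-comm xs ys P f) ⟩
      sumOver (filter (λ y → T? (P x y)) ys) f + sumOver ys (count xs)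
        ≈⟨ step ys ⟩
      sumOver ys (count (x ∷ xs)) ∎
      where
      count : List B → C → Carrier
      count xs y = length (filter (λ x → T? (P x y)) xs) · f y

      step : ∀ ys → sumOver (filter (λ y → T? (P x y)) ys) f + sumOver ys (count xs) ≈
        sumOver ys (count (x ∷ xs))
      step []       = +-identityˡ 0#
      step (y ∷ ys) with P x y
      ... | true  = trans (interchange (f y) _ _ _) (+-congˡ (step ys))
      ... | false = trans (x∙yz≈y∙xz _ (count xs y) _) (+-congˡ (step ys))

-- Averaging over the choices of the added edge.

module LowerBound {a ℓ₁ ℓ₂ ℓ₃} (ℝ : Reals a ℓ₁ ℓ₂ ℓ₃) (m : ℕ) {n} (m*4≤n : m ℕ.* 4 ℕ.≤ n) where
  open Reals ℝ
  open Probability ℝ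
  open RealProperties ℝ
  open ≤-Reasoning
  open Pairs m m*4≤n

  module _ {ε} (0<ε : 0# < ε) (𝓔 : Encoder n) (dp : IsDPEncoder ε 𝓔)
           {α} (ratio : HasApproximationRatio 𝓔 α) where

    -- The sum is the expected number of events `P j` that occur. In each order, every one of them
    -- accounts for a selected vertex, so the ratio at `k = 1` bounds it.
    sum-Pr≤α : ∀ s i (P : Fin m → Ranking n → Bool) →
      (∀ j π → T (P j π) → rank π (head π (not s) j) ℕ.≤ rank π (head π s i)) →
      sumOver (allFin m) (λ j → Pr (𝓔 G[ s , i ] 1) (P j)) ≤ α
    sum-Pr≤α s i P first = begin
      sumOver (allFin m) (λ j → Pr μ (P j))
        ≈⟨ sumOver-filter-comm (allFin m) (permutations n) P (mass μ) ⟩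
      sumOver (permutations n) (λ π → length (filter (λ j → T? (P j π)) (allFin m)) · mass μ π)
        ≤⟨ sumOver-mono-≤ (All.map (λ {π} → ·-monoˡ-≤
             (length≤∣decode∣ π s i (λ j → P j π) (λ j → first j π))) (mass-≥0 μ)) ⟩
      sumOver (permutations n) (λ π → ∣ decode G[ s , i ] π ∣ · mass μ π)
        ≈⟨ sumOver-cong (permutations n) (λ π → *-fromℕ (mass μ π) ∣ decode G[ s , i ] π ∣) ⟨
      𝔼 μ (λ π → fromℕ ∣ decode G[ s , i ] π ∣)
        ≤⟨ ratio G[ s , i ] 1 (opt-bipartite+edge≤1 side (pair-distinct s i)) ⟩
      α * fromℕ 1
        ≈⟨ trans (*-fromℕ α 1) (×-homo-1 α) ⟩
      α ∎
      where μ = 𝓔 G[ s , i ] 1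

    μ₀ : Distribution (permutations n)
    μ₀ = 𝓔 G₀ 1

    -- Privacy, applied to each event, replaces the order drawn for `G[ s , i ]` by the one drawn
    -- for `G₀`. That distribution is the same for all edges, so the bounds can be added up.
    sum-Pr₀≤exp*α : ∀ s i (P : Fin m → Ranking n → Bool) →
      (∀ j π → T (P j π) → rank π (head π (not s) j) ℕ.≤ rank π (head π s i)) →
      sumOver (allFin m) (λ j → Pr μ₀ (P j)) ≤ exp ε * α
    sum-Pr₀≤exp*α s i P first = begin
      sumOver (allFin m) (λ j → Pr μ₀ (P j))
        ≤⟨ sumOver-mono-≤ (All.universal
             (λ j → dp 1 G₀ G[ s , i ] (addEdge-neighbours G₀ (pair-distinct s i)) (P j)) (allFin m)) ⟩
      sumOver (allFin m) (λ j → exp ε * Pr (𝓔 G[ s , i ] 1) (P j))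
        ≈⟨ *-distribˡ-sumOver (exp ε) (allFin m) _ ⟨
      exp ε * sumOver (allFin m) (λ j → Pr (𝓔 G[ s , i ] 1) (P j))
        ≤⟨ *-monoʳ-≤ (exp-positive (<-asym 0<ε)) (sum-Pr≤α s i P first) ⟩
      exp ε * α ∎

    first? : ∀ i j (π : Ranking n) → Dec (rank π (head π false i) ℕ.≤ rank π (head π true j))
    first? i j π = rank π (head π false i) ℕ.≤? rank π (head π true j)

    first : Fin m → Fin m → Ranking n → Bool
    first i j π = does (first? i j π)

    -- When first i j holds, the pair i is hit by the edge on the pair j;
    -- otherwise the pair j is hit by the edge on the pair i.
    m²≤2m*exp*α : m · (m · 1#) ≤ m · (exp ε * α) + m · (exp ε * α)
    m²≤2m*exp*α = begin
      m · (m · 1#)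
        ≈⟨ ×-congʳ m (sum-allFin 1#) ⟨
      m · sumOver (allFin m) (λ _ → 1#)
        ≈⟨ sum-allFin _ ⟨
      sumOver (allFin m) (λ i → sumOver (allFin m) (λ j → 1#))
        -- For each `i` and `j`, the event `first i j` and its complement share total mass 1.
        ≈⟨ sumOver-cong (allFin m) (λ i → sumOver-cong (allFin m) (λ j →
             trans (sumOver-filter-not (permutations n) (first i j) (mass μ₀)) (mass-sum μ₀))) ⟨
      sumOver (allFin m) (λ i → sumOver (allFin m) (λ j → Pr μ₀ (first i j) + Pr μ₀ (not ∘ first i j)))
        ≈⟨ trans (sumOver-cong (allFin m) (λ i → sumOver-+ (allFin m) _ _)) (sumOver-+ (allFin m) _ _) ⟩
      sumOver (allFin m) (λ i → sumOver (allFin m) (λ j → Pr μ₀ (first i j))) +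
      sumOver (allFin m) (λ i → sumOver (allFin m) (λ j → Pr μ₀ (not ∘ first i j)))
        -- Each inner sum must keep the added edge fixed: it joins pair `j` of side `true` in the
        -- first half, pair `i` of side `false` in the second.
        ≈⟨ +-congʳ (sumOver-comm (allFin m) (allFin m) _) ⟩
      sumOver (allFin m) (λ j → sumOver (allFin m) (λ i → Pr μ₀ (first i j))) +
      sumOver (allFin m) (λ i → sumOver (allFin m) (λ j → Pr μ₀ (not ∘ first i j)))
        ≤⟨ +-mono-≤
             (sumOver-mono-≤ (All.universal (λ j → sum-Pr₀≤exp*α true j (λ i → first i j)
               (λ i π → T-does⁻ (first? i j π))) (allFin m)))
             (sumOver-mono-≤ (All.universal (λ i → sum-Pr₀≤exp*α false i (λ j → not ∘ first i j)
               (λ j π → ℕ.≰⇒≥ ∘ T-does⁻ (¬? (first? i j π)))) (allFin m))) ⟩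
      sumOver (allFin m) (λ j → exp ε * α) + sumOver (allFin m) (λ i → exp ε * α)
        ≈⟨ +-cong (sum-allFin _) (sum-allFin _) ⟩
      m · (exp ε * α) + m · (exp ε * α) ∎
      where
      sum-allFin : ∀ x → sumOver (allFin m) (λ _ → x) ≈ m · x
      sum-allFin x = trans (sumOver-const (allFin m) x) (×-congˡ (length-tabulate {n = m} id))

    -- Otherwise `exp ε * α` would be less than `n · c`, thus less than `8m · c`, and `2m` times
    -- this is `16m² · c`, that is `m²`, against the inequality above. The 16 is the product of this
    -- 2 and 8.
    ratio-bound : .{{_ : ℕ.NonZero m}} → n ℕ.≤ m ℕ.* 8 → ∀ {c} → 0# < c → 16 · c ≈ 1# →
      c * fromℕ n * exp (- ε) ≤ α
    ratio-bound n≤m*8 {c} 0<c 16c≈1 α<cne⁻ᵉ = <-irrefl refl (begin-strict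
      m · (m · 1#)                   ≤⟨ m²≤2m*exp*α ⟩
      m · K + m · K                  ≈⟨ ×-homo-+ K m m ⟨
      -- Strictness survives the multiplication because `m + m` is nonzero.
      (m ℕ.+ m) · K                  <⟨ ·-monoʳ-< (m ℕ.+ m) {{m+m≢0}} K<8mc ⟩
      (m ℕ.+ m) · ((m ℕ.* 8) · c)    ≈⟨ ×-assocˡ c (m ℕ.+ m) (m ℕ.* 8) ⟩
      ((m ℕ.+ m) ℕ.* (m ℕ.* 8)) · c  ≡⟨ ≡.cong (_· c) (arithmetic m) ⟩
      (m ℕ.* (m ℕ.* 16)) · c         ≈⟨ ×-assocˡ c m (m ℕ.* 16) ⟨
      m · ((m ℕ.* 16) · c)           ≈⟨ ×-congʳ m (×-assocˡ c m 16) ⟨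
      m · (m · (16 · c))             ≈⟨ ×-congʳ m (×-congʳ m 16c≈1) ⟩
      m · (m · 1#)                   ∎)
      where
      K = exp ε * α

      arithmetic : ∀ m → (m ℕ.+ m) ℕ.* (m ℕ.* 8) ≡ m ℕ.* (m ℕ.* 16)
      arithmetic = solve-∀

      m+m≢0 : ℕ.NonZero (m ℕ.+ m)
      m+m≢0 = ℕ.>-nonZero (ℕ.<-≤-trans (ℕ.>-nonZero⁻¹ m) (ℕ.m≤m+n m m))

      K<8mc : K < (m ℕ.* 8) · c
      K<8mc = begin-strict
        exp ε * α                          <⟨ *-monoʳ-< (exp-positive (<-asym 0<ε)) α<cne⁻ᵉ ⟩
        exp ε * (c * fromℕ n * exp (- ε))  ≈⟨ *-comm (exp ε) _ ⟩
        c * fromℕ n * exp (- ε) * exp ε    ≈⟨ *-assoc _ (exp (- ε)) (exp ε) ⟩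
        c * fromℕ n * (exp (- ε) * exp ε)  ≈⟨ *-congˡ (exp-inverse ε) ⟩
        c * fromℕ n * 1#                   ≈⟨ trans (*-identityʳ _) (*-fromℕ c n) ⟩
        n · c                              ≤⟨ ·-monoˡ-≤ n≤m*8 (<-asym 0<c) ⟩
        (m ℕ.* 8) · c                      ∎

-- The choice of the constants.

theorem36 : ∀ {a ℓ₁ ℓ₂ ℓ₃} (ℝ : Reals a ℓ₁ ℓ₂ ℓ₃) →
    let open Reals ℝ
        open Probability ℝ
    in  Σ[ c ∈ Carrier ] (0# < c × ∃[ n₀ ] (
          ∀ (n : ℕ) → n₀ ℕ.≤ n →
          ∀ (ε : Carrier) → 0# < ε →
          ∀ (𝓔 : Encoder n) → IsDPEncoder ε 𝓔 →
          ∀ (α : Carrier) → HasApproximationRatio 𝓔 α →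
          c * fromℕ n * exp (- ε) ≤ α))
-- Here `c` is 1/16 and `m` is `n / 4`; the threshold 4 makes `m` nonzero.
theorem36 ℝ = c , 0<c , 4 , λ n 4≤n ε 0<ε 𝓔 dp α ratio →
  LowerBound.ratio-bound ℝ (n ℕ./ 4) (m/n*n≤m n 4) 0<ε 𝓔 dp ratio {{ℕ.>-nonZero (m≥n⇒m/n>0 4≤n)}}
    (n≤n/4*8 n 4≤n) 0<c (trans (sym (*-fromℕ c 16)) (trans (*-comm c (fromℕ 16)) 16*c≈1))
  where
  open Reals ℝ
  open RealProperties ℝ

  inverse : ∃[ c ] (0# < c × fromℕ 16 * c ≈ 1#)
  inverse = positive-inverse (·-positive 16 0<1)

  c = proj₁ inverse
  0<c = proj₁ (proj₂ inverse)
  16*c≈1 = proj₂ (proj₂ inverse)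

  -- Rounding loses at most a factor of 2: the remainder is below 4, which is at most `n / 4 * 4`.
  n≤n/4*8 : ∀ n → 4 ℕ.≤ n → n ℕ.≤ n ℕ./ 4 ℕ.* 8
  n≤n/4*8 n 4≤n = begin
    n                                  ≡⟨ m≡m%n+[m/n]*n n 4 ⟩
    n ℕ.% 4 ℕ.+ n ℕ./ 4 ℕ.* 4          ≤⟨ ℕ.+-monoˡ-≤ _ (ℕ.<⇒≤ (m%n<n n 4)) ⟩
    1 ℕ.* 4 ℕ.+ n ℕ./ 4 ℕ.* 4          ≤⟨ ℕ.+-monoˡ-≤ _ (ℕ.*-monoˡ-≤ 4 (m≥n⇒m/n>0 4≤n)) ⟩
    n ℕ./ 4 ℕ.* 4 ℕ.+ n ℕ./ 4 ℕ.* 4    ≡⟨ ℕ.*-distribˡ-+ (n ℕ./ 4) 4 4 ⟨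
    n ℕ./ 4 ℕ.* 8                      ∎
    where open ℕ.≤-Reasoning
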